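{- Let $D_N=\sum_{k=0}^{N}\binom{N}{k}^2 2^k$ denote the $N$-th central Delannoy number. For every non-negative integer $n$, $$v_3(D_{2n+1})=1+v_3(2n+1)+v_3\Big(\binom{2n}{n}\Big),\qquad v_3(D_{2n})=v_3\Big(\binom{2n}{n}\Big).$$
   Context: $v_3(y)$ denotes the $3$-adic valuation of a nonzero integer $y$. Equivalently, $D_N$ is the number of lattice paths from $(0,0)$ to $(N,N)$ using steps $(1,0)$, $(0,1)$, $(1,1)$. -}

module Defs where

open import Data.Bool.Base using (if_then_else_)
open import Data.List.Base using (map; upTo)
open import Data.Nat.Base
open import Data.Nat.Combinatorics using (_C_; k![n∸k]!∣n!)
open import Data.Nat.Combinatorics.Specification using (nCk≡n!/k![n-k]!)
open import Data.Nat.Divisibility using (_∣_; _∣?_; 1∣_; ∣⇒≤)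
open import Data.Nat.DivMod using (m≥n⇒m/n>0)
open import Data.Nat.ListAction using (sum)
open import Data.Nat.Properties
open import Relation.Binary.PropositionalEquality using (sym; subst)
open import Relation.Nullary using (does; yes; no; contradiction)

largestExponent≤ : (b p n : ℕ) → ℕ
largestExponent≤ zero    p n = 0
largestExponent≤ (suc b) p n =
  if does (p ^ suc b ∣? n) then suc b else largestExponent≤ b p n

-- The bound n loses nothing: if p ≥ 2 and n ≢ 0, then p ^ e ∣ n gives
-- e < p ^ e ≤ n. See ^valuation∣ and ^∣⇒≤valuation below.

valuation : (p n : ℕ) .{{_ : NonTrivial p}} .{{_ : NonZero n}} → ℕ
valuation p n = largestExponent≤ n p n

v₃ : (n : ℕ) .{{_ : NonZero n}} → ℕ
v₃ n = valuation 3 n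

D : ℕ → ℕ
D N = sum (map (λ k → (N C k) ^ 2 * 2 ^ k) (upTo (suc N)))

private
  ^largestExponent≤∣ : ∀ b p n → p ^ largestExponent≤ b p n ∣ n
  ^largestExponent≤∣ zero    p n = 1∣ n
  ^largestExponent≤∣ (suc b) p n with p ^ suc b ∣? n
  ... | yes p^b∣n = p^b∣n
  ... | no  _     = ^largestExponent≤∣ b p n

  ≤largestExponent≤ : ∀ b p n {e} → e ≤ b → p ^ e ∣ n →
                      e ≤ largestExponent≤ b p n
  ≤largestExponent≤ zero    p n e≤b p^e∣n = e≤b
  ≤largestExponent≤ (suc b) p n {e} e≤b p^e∣n with p ^ suc b ∣? n
  ... | yes _ = e≤b
  ... | no p^b∤n with e ≟ suc b
  ...   | yes e≡b = contradiction (subst (λ i → p ^ i ∣ n) e≡b p^e∣n) p^b∤n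
  ...   | no  e≢b = ≤largestExponent≤ b p n (≤-pred (≤∧≢⇒< e≤b e≢b)) p^e∣n

  e<p^e : ∀ p e .{{_ : NonTrivial p}} → e < p ^ e
  e<p^e p zero    = z<s
  e<p^e p (suc e) = ≤-<-trans (e<p^e p e)
    (^-monoʳ-< p (nonTrivial⇒n>1 p) (n<1+n e))
    where instance _ = nonTrivial⇒nonZero p

^valuation∣ : ∀ p n .{{_ : NonTrivial p}} .{{_ : NonZero n}} →
              p ^ valuation p n ∣ n
^valuation∣ p n = ^largestExponent≤∣ n p n

^∣⇒≤valuation : ∀ p n .{{_ : NonTrivial p}} .{{_ : NonZero n}} {e} →
                p ^ e ∣ n → e ≤ valuation p n
^∣⇒≤valuation p n {e} p^e∣n =
  ≤largestExponent≤ n p n (≤-trans (<⇒≤ (e<p^e p e)) (∣⇒≤ p^e∣n)) p^e∣n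

C-nonZero : ∀ {n k} → k ≤ n → NonZero (n C k)
C-nonZero {n} {k} k≤n = >-nonZero (subst (0 <_) (sym (nCk≡n!/k![n-k]! k≤n))
  (m≥n⇒m/n>0 (∣⇒≤ (k![n∸k]!∣n! k≤n))))
  where instance
    _ = n !≢0
    _ = k !* (n ∸ k) !≢0

2nCn-nonZero : ∀ n → NonZero ((2 * n) C n)
2nCn-nonZero n = C-nonZero (m≤m+n n (n + 0))

{-# OPTIONS --safe #-}
module Submission where

-- Put N = s + 2n with s ≤ 1. The operators 1 + K and 1 + L, where K and L shift
-- the two indices of h(k, l) = [k = l] 2ᵏ, satisfy KL = 2 on h, so
-- (1 + K)ᴺ(1 + L)ᴺ = (3 + K + L)ᴺ; evaluating at (0, 0) gives
--   D_N = Σ_q (N C 2q) (2q C q) 2^q 3^(N - 2q).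
-- With r = N - 2q, the number r! (N C 2q) (2q C q) is a multiple of
-- M = (N C 2n) (2n C n), while v₃(r!) ≤ r - 2 for r ≥ 2. Hence every term with
-- q < n is divisible by 3^(v₃(M) + 2), and the term q = n, which is M 2ⁿ 3ˢ,
-- determines the valuation.

open import Defs
open import Data.List.Base using (applyUpTo)
open import Data.List.Properties using (map-upTo)
open import Data.Nat.Base using
  (ℕ; zero; suc; _+_; _*_; _∸_; _^_; _!; _≤_; _<_; z≤n; s≤s; z<s; s<s;
   NonZero; NonTrivial; nonTrivial⇒nonZero)
open import Data.Nat.Combinatorics using
  (_C_; nCn≡1; nC1≡n; k>n⇒nCk≡0; nCk≡nC[n∸k]; nCk+nC[k+1]≡[n+1]C[k+1];
   nCk≡n!/k![n-k]!; k![n∸k]!∣n!)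
open import Data.Nat.Divisibility using
  (_∣_; divides; divides-refl; _∣0; 1∣_; ∣1⇒≡1; >⇒∤; ∣-trans; ∣m∣n⇒∣m+n; ∣m+n∣m⇒∣n;
   m∣m*n; n∣m*n; ∣m⇒∣m*n; *-monoʳ-∣; *-monoˡ-∣; *-cancelˡ-∣; m≤n⇒m!∣n!)
open import Data.Nat.DivMod using (_/_; _%_; m/n*n≡m; m≡m%n+[m/n]*n; m%n<n)
open import Data.Nat.Induction using (<-rec)
open import Data.Nat.ListAction using (sum)
open import Data.Nat.Properties
open import Data.Nat.Tactic.RingSolver using (solve-∀)
open import Data.Nat.Primality using (Prime; prime?; euclidsLemma; prime⇒nonZero)
open import Data.Product.Base using (_×_; _,_; ∃-syntax)
open import Data.Sum.Base using (_⊎_; inj₁; inj₂)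
open import Function.Base using (_∘_)
open import Relation.Binary.PropositionalEquality using
  (_≡_; _≢_; refl; sym; trans; cong; cong₂; subst; subst₂; module ≡-Reasoning)
open import Relation.Nullary using (¬_; contradiction)
open import Relation.Nullary.Decidable using (from-yes)

open ≡-Reasoning

private
  variable
    c   : ℕ
    f g : ℕ → ℕ

-- Finite sums.

∑ : ℕ → (ℕ → ℕ) → ℕ
∑ n f = sum (applyUpTo f n)

∑-cong : ∀ n → (∀ i → i < n → f i ≡ g i) → ∑ n f ≡ ∑ n g
∑-cong zero    f≗g = refl
∑-cong (suc n) f≗g =
  cong₂ _+_ (f≗g 0 z<s) (∑-cong n (λ i i<n → f≗g (suc i) (s<s i<n)))

∑-zero : ∀ n → (∀ i → i < n → f i ≡ 0) → ∑ n f ≡ 0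
∑-zero zero    f≗0 = refl
∑-zero (suc n) f≗0 =
  cong₂ _+_ (f≗0 0 z<s) (∑-zero n (λ i i<n → f≗0 (suc i) (s<s i<n)))

∑-suc : ∀ n f → ∑ (suc n) f ≡ ∑ n f + f n
∑-suc zero    f = +-identityʳ (f 0)
∑-suc (suc n) f = trans (cong (f 0 +_) (∑-suc n (f ∘ suc)))
                        (sym (+-assoc (f 0) (∑ n (f ∘ suc)) (f (suc n))))

∑-+ : ∀ n f g → ∑ n (λ i → f i + g i) ≡ ∑ n f + ∑ n g
∑-+ zero    f g = refl
∑-+ (suc n) f g = trans (cong (f 0 + g 0 +_) (∑-+ n (f ∘ suc) (g ∘ suc)))
                        (interchange (f 0) (g 0) _ _)
  where
  interchange : ∀ a b c d → (a + b) + (c + d) ≡ (a + c) + (b + d)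
  interchange = solve-∀

∑-*ˡ : ∀ n c f → c * ∑ n f ≡ ∑ n (λ i → c * f i)
∑-*ˡ zero    c f = *-zeroʳ c
∑-*ˡ (suc n) c f = trans (*-distribˡ-+ c (f 0) _)
                         (cong (c * f 0 +_) (∑-*ˡ n c (f ∘ suc)))

∑-single : ∀ n {m} → m < n → (∀ i → i < n → i ≢ m → f i ≡ 0) → ∑ n f ≡ f m
∑-single (suc n) {zero}  _         f≗0 =
  trans (cong (_ +_) (∑-zero n (λ i i<n → f≗0 (suc i) (s<s i<n) λ ())))
        (+-identityʳ _)
∑-single (suc n) {suc m} (s<s m<n) f≗0 =
  cong₂ _+_ (f≗0 0 z<s λ ())
    (∑-single n m<n (λ i i<n i≢m → f≗0 (suc i) (s<s i<n) (i≢m ∘ suc-injective)))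

∑-∣ : ∀ {d} n → (∀ i → i < n → d ∣ f i) → d ∣ ∑ n f
∑-∣ zero    d∣f = _ ∣0
∑-∣ (suc n) d∣f =
  ∣m∣n⇒∣m+n (d∣f 0 z<s) (∑-∣ n (λ i i<n → d∣f (suc i) (s<s i<n)))

-- Powers of `c + E` and the binomial theorem.

-- The operator (c + E)ⁿ applied to h and evaluated at 0, where E h = h ∘ suc.
[_+E]^_ : ℕ → ℕ → (ℕ → ℕ) → ℕ
([ c +E]^ zero)  h = h 0
([ c +E]^ suc n) h = c * ([ c +E]^ n) h + ([ c +E]^ n) (h ∘ suc)

+E-cong : ∀ n → (∀ k → k ≤ n → f k ≡ g k) → ([ c +E]^ n) f ≡ ([ c +E]^ n) g
+E-cong zero        f≗g = f≗g 0 z≤n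
+E-cong {c = c} (suc n) f≗g =
  cong₂ _+_ (cong (c *_) (+E-cong n (λ k k≤n → f≗g k (m≤n⇒m≤1+n k≤n))))
            (+E-cong n (λ k k≤n → f≗g (suc k) (s≤s k≤n)))

+E-+ : ∀ n f g → ([ c +E]^ n) (λ k → f k + g k) ≡ ([ c +E]^ n) f + ([ c +E]^ n) g
+E-+ zero    f g = refl
+E-+ {c} (suc n) f g =
  trans (cong₂ _+_ (cong (c *_) (+E-+ n f g)) (+E-+ n (f ∘ suc) (g ∘ suc)))
        (regroup c _ _ _ _)
  where
  regroup : ∀ c x y z w → c * (x + y) + (z + w) ≡ (c * x + z) + (c * y + w)
  regroup = solve-∀

+E-*ˡ : ∀ n a f → ([ c +E]^ n) (λ k → a * f k) ≡ a * ([ c +E]^ n) f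
+E-*ˡ zero    a f = refl
+E-*ˡ {c} (suc n) a f =
  trans (cong₂ _+_ (cong (c *_) (+E-*ˡ n a f)) (+E-*ˡ n a (f ∘ suc)))
        (regroup a c _ _)
  where
  regroup : ∀ a c x y → c * (a * x) + a * y ≡ a * (c * x + y)
  regroup = solve-∀

-- The binomial theorem for the commuting operators `c` and `E`: one more factor splits the sum into
-- an unshifted part `a` and a shifted part `b`, which Pascal's rule recombines index by index.
+E-expand : ∀ c n h →
  ([ c +E]^ n) h ≡ ∑ (suc n) (λ k → (n C k) * (c ^ (n ∸ k) * h k))
+E-expand c zero    h = unit (h 0)
  where
  unit : ∀ x → x ≡ 1 * (1 * x) + 0
  unit = solve-∀
+E-expand c (suc n) h = begin
  c * ([ c +E]^ n) h + ([ c +E]^ n) (h ∘ suc)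
    ≡⟨ cong₂ _+_ (cong (c *_) (+E-expand c n h)) (+E-expand c n (h ∘ suc)) ⟩
  c * ∑ (suc n) (λ k → (n C k) * (c ^ (n ∸ k) * h k)) + ∑ (suc n) b
    ≡⟨ cong (_+ ∑ (suc n) b) (∑-*ˡ (suc n) c (λ k → (n C k) * (c ^ (n ∸ k) * h k))) ⟩
  ∑ (suc n) (λ k → c * ((n C k) * (c ^ (n ∸ k) * h k))) + ∑ (suc n) b
    ≡⟨ cong (_+ ∑ (suc n) b) (∑-cong (suc n) (λ k k<1+n → absorb k (≤-pred k<1+n))) ⟩
  ∑ (suc n) a + ∑ (suc n) b
    -- The vanishing term `a (suc n)` is appended, so that splitting off `a 0` leaves a sum of the
    -- same length as that of `b`.
    ≡⟨ cong (_+ ∑ (suc n) b) (trans (∑-suc (suc n) a)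
         (trans (cong (∑ (suc n) a +_) a[1+n]≡0) (+-identityʳ _))) ⟨
  ∑ (2 + n) a + ∑ (suc n) b
    ≡⟨ rotate (a 0) (∑ (suc n) (a ∘ suc)) (∑ (suc n) b) ⟩
  a 0 + (∑ (suc n) b + ∑ (suc n) (a ∘ suc))
    ≡⟨ cong (a 0 +_) (∑-+ (suc n) b (a ∘ suc)) ⟨
  a 0 + ∑ (suc n) (λ k → b k + a (suc k))
    ≡⟨ cong (a 0 +_) (∑-cong (suc n) (λ k _ → pascal k)) ⟩
  ∑ (2 + n) (λ k → (suc n C k) * (c ^ (suc n ∸ k) * h k)) ∎
  where
  a b : ℕ → ℕ
  a k = (n C k) * (c ^ (suc n ∸ k) * h k)
  b k = (n C k) * (c ^ (n ∸ k) * h (suc k))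
  a[1+n]≡0 : a (suc n) ≡ 0
  a[1+n]≡0 = cong (_* (c ^ (n ∸ n) * h (suc n))) (k>n⇒nCk≡0 (n<1+n n))
  shuffle : ∀ c x y z → c * (x * (y * z)) ≡ x * (c * y * z)
  shuffle = solve-∀
  absorb : ∀ k → k ≤ n → c * ((n C k) * (c ^ (n ∸ k) * h k)) ≡ a k
  absorb k k≤n = trans (shuffle c (n C k) (c ^ (n ∸ k)) (h k))
    (cong (λ e → (n C k) * (c ^ e * h k)) (sym (+-∸-assoc 1 k≤n)))
  rotate : ∀ x y z → x + y + z ≡ x + (z + y)
  rotate = solve-∀
  pascal : ∀ k → b k + a (suc k) ≡ (suc n C suc k) * (c ^ (n ∸ k) * h (suc k))
  pascal k = trans (sym (*-distribʳ-+ (c ^ (n ∸ k) * h (suc k)) (n C k) (n C suc k)))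
                   (cong (_* (c ^ (n ∸ k) * h (suc k))) (nCk+nC[k+1]≡[n+1]C[k+1] n k))

-- Two commuting shifts.

K L : (ℕ → ℕ → ℕ) → ℕ → ℕ → ℕ
K h k l = h (suc k) l
L h k l = h k (suc l)

-- The operator (K + L)ʲ followed by evaluation at (0, 0).
[K+L]^_ : ℕ → (ℕ → ℕ → ℕ) → ℕ
([K+L]^ zero)  h = h 0 0
([K+L]^ suc j) h = ([K+L]^ j) (K h) + ([K+L]^ j) (L h)

-- Here `m` counts the factors from which `K` is chosen; the other `j ∸ m` contribute `L`. One more
-- `L` turns `j ∸ m` into `suc (j ∸ m)`, which is `suc j ∸ m` only for `m ≤ j`; hence the bounded
-- hypothesis of `+E-cong`.
[K+L]^-expand : ∀ j h → ([K+L]^ j) h ≡ ([ 1 +E]^ j) (λ m → h m (j ∸ m))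
[K+L]^-expand zero    h = refl
[K+L]^-expand (suc j) h = begin
  ([K+L]^ j) (K h) + ([K+L]^ j) (L h)
    ≡⟨ +-comm (([K+L]^ j) (K h)) _ ⟩
  ([K+L]^ j) (L h) + ([K+L]^ j) (K h)
    ≡⟨ cong₂ _+_ ([K+L]^-expand j (L h)) ([K+L]^-expand j (K h)) ⟩
  ([ 1 +E]^ j) (λ m → h m (suc (j ∸ m))) + Kterm
    ≡⟨ cong (_+ Kterm) (+E-cong j (λ m m≤j → cong (h m) (+-∸-assoc 1 m≤j))) ⟨
  ([ 1 +E]^ j) (λ m → h m (suc j ∸ m)) + Kterm
    ≡⟨ cong (_+ Kterm) (*-identityˡ _) ⟨
  1 * ([ 1 +E]^ j) (λ m → h m (suc j ∸ m)) + Kterm ∎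
  where Kterm = ([ 1 +E]^ j) (λ m → h (suc m) (j ∸ m))

-- (1 + K)ⁿ (1 + L)ⁿ = (1 + K + L + KL)ⁿ, and KL acts as the scalar t.
[1+K][1+L]≡[1+t]+[K+L] : ∀ t n h → (∀ k l → h (suc k) (suc l) ≡ t * h k l) →
  ([ 1 +E]^ n) (λ k → ([ 1 +E]^ n) (h k)) ≡
  ([ 1 + t +E]^ n) (λ j → ([K+L]^ j) h)
[1+K][1+L]≡[1+t]+[K+L] t zero    h KL≡t = refl
[1+K][1+L]≡[1+t]+[K+L] t (suc n) h KL≡t = begin
  1 * B (λ k → 1 * B (h k) + B (L h k)) + B (λ k → 1 * B (K h k) + B (L (K h) k))
    ≡⟨ cong₂ (λ x y → 1 * x + y) (split h) (split (K h)) ⟩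
  1 * (BB h + BB (L h)) + (BB (K h) + BB (L (K h)))
    ≡⟨ cong (λ x → 1 * (BB h + BB (L h)) + (BB (K h) + x)) scalar ⟩
  1 * (BB h + BB (L h)) + (BB (K h) + t * BB h)
    ≡⟨ regroup t (BB h) (BB (L h)) (BB (K h)) ⟩
  (1 + t) * BB h + (BB (K h) + BB (L h))
    -- The induction hypothesis is applied to `h`, `K h` and `L h`, each of which inherits the law
    -- `KL = t`. This is why the identity is stated for every such `h`.
    ≡⟨ cong₂ _+_ (cong ((1 + t) *_) ([1+K][1+L]≡[1+t]+[K+L] t n h KL≡t))
         (cong₂ _+_ ([1+K][1+L]≡[1+t]+[K+L] t n (K h) (λ k l → KL≡t (suc k) l))
                    ([1+K][1+L]≡[1+t]+[K+L] t n (L h) (λ k l → KL≡t k (suc l)))) ⟩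
  (1 + t) * A (λ j → ([K+L]^ j) h) +
    (A (λ j → ([K+L]^ j) (K h)) + A (λ j → ([K+L]^ j) (L h)))
    ≡⟨ cong ((1 + t) * A (λ j → ([K+L]^ j) h) +_)
         (+E-+ n (λ j → ([K+L]^ j) (K h)) (λ j → ([K+L]^ j) (L h))) ⟨
  (1 + t) * A (λ j → ([K+L]^ j) h) + A (λ j → ([K+L]^ suc j) h) ∎
  where
  A B : (ℕ → ℕ) → ℕ
  A = [ 1 + t +E]^ n
  B = [ 1 +E]^ n
  BB : (ℕ → ℕ → ℕ) → ℕ
  BB u = B (λ k → B (u k))
  split : ∀ u → B (λ k → 1 * B (u k) + B (L u k)) ≡ BB u + BB (L u)
  split u = trans (+E-+ n (λ k → 1 * B (u k)) (λ k → B (L u k)))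
    (cong (_+ BB (L u)) (trans (+E-*ˡ n 1 (λ k → B (u k))) (*-identityˡ _)))
  scalar : BB (L (K h)) ≡ t * BB h
  scalar = trans
    (+E-cong n (λ k _ → trans (+E-cong n (λ l _ → KL≡t k l)) (+E-*ˡ n t (h k))))
    (+E-*ˡ n t (λ k → B (h k)))
  regroup : ∀ t x y z → 1 * (x + y) + (z + t * x) ≡ (1 + t) * x + (z + y)
  regroup = solve-∀

-- The diagonal function and the expansion of `D`.

-- The recursion on both indices makes the law `KL = t` hold by `refl`.
diag : ℕ → ℕ → ℕ → ℕ
diag t zero    zero    = 1
diag t (suc k) (suc l) = t * diag t k l
diag t _       _       = 0

diag-≡ : ∀ t k → diag t k k ≡ t ^ k
diag-≡ t zero    = refl
diag-≡ t (suc k) = cong (t *_) (diag-≡ t k)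

diag-≢ : ∀ t k l → k ≢ l → diag t k l ≡ 0
diag-≢ t zero    zero    k≢l = contradiction refl k≢l
diag-≢ t zero    (suc l) k≢l = refl
diag-≢ t (suc k) zero    k≢l = refl
diag-≢ t (suc k) (suc l) k≢l =
  trans (cong (t *_) (diag-≢ t k l (k≢l ∘ cong suc))) (*-zeroʳ t)

[1+E]^-diag : ∀ t n k → ([ 1 +E]^ n) (diag t k) ≡ (n C k) * t ^ k
[1+E]^-diag t zero    zero    = refl
[1+E]^-diag t zero    (suc k) = refl
-- The shifted function is constantly 0, and 0 is a multiple of 0, so the factor 0 can be pulled out
-- of the operator.
[1+E]^-diag t (suc n) zero    = cong₂ (λ x y → 1 * x + y)
  ([1+E]^-diag t n zero) (+E-*ˡ n 0 (λ _ → 0))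
[1+E]^-diag t (suc n) (suc k) = begin
  1 * ([ 1 +E]^ n) (diag t (suc k)) + ([ 1 +E]^ n) (λ l → t * diag t k l)
    ≡⟨ cong₂ (λ x y → 1 * x + y) ([1+E]^-diag t n (suc k))
         (trans (+E-*ˡ n t (diag t k)) (cong (t *_) ([1+E]^-diag t n k))) ⟩
  1 * ((n C suc k) * (t * t ^ k)) + t * ((n C k) * t ^ k)
    ≡⟨ collect t (n C suc k) (n C k) (t ^ k) ⟩
  (n C k + n C suc k) * (t * t ^ k)
    ≡⟨ cong (_* (t * t ^ k)) (nCk+nC[k+1]≡[n+1]C[k+1] n k) ⟩
  (suc n C suc k) * (t * t ^ k) ∎
  where
  collect : ∀ t x y z → 1 * (x * (t * z)) + t * (y * z) ≡ (y + x) * (t * z)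
  collect = solve-∀

-- This is the constant term of `(x + t / x) ^ j`.
central : ℕ → ℕ → ℕ
central t j = ([K+L]^ j) (diag t)

central-∑ : ∀ t j → central t j ≡ ∑ (suc j) (λ m → (j C m) * diag t m (j ∸ m))
central-∑ t j = begin
  central t j
    ≡⟨ [K+L]^-expand j (diag t) ⟩
  ([ 1 +E]^ j) (λ m → diag t m (j ∸ m))
    ≡⟨ +E-expand 1 j (λ m → diag t m (j ∸ m)) ⟩
  ∑ (suc j) (λ m → (j C m) * (1 ^ (j ∸ m) * diag t m (j ∸ m)))
    ≡⟨ ∑-cong (suc j) (λ m _ → cong ((j C m) *_)
         (trans (cong (_* diag t m (j ∸ m)) (^-zeroˡ (j ∸ m))) (*-identityˡ _))) ⟩
  ∑ (suc j) (λ m → (j C m) * diag t m (j ∸ m)) ∎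

2*m∸m≡m : ∀ m → 2 * m ∸ m ≡ m
2*m∸m≡m m = trans (m+n∸m≡n m (m + 0)) (+-identityʳ m)

m≡n∸m⇒n≡2*m : ∀ {m n} → m ≤ n → m ≡ n ∸ m → n ≡ 2 * m
m≡n∸m⇒n≡2*m {m} {n} m≤n m≡n∸m = begin
  n           ≡⟨ m+[n∸m]≡n m≤n ⟨
  m + (n ∸ m) ≡⟨ cong (m +_) m≡n∸m ⟨
  m + m       ≡⟨ cong (m +_) (+-identityʳ m) ⟨
  2 * m       ∎

-- `diag` keeps only the choices with as many factors `K` as `L`, that is `m ≡ q`. For an odd number
-- of factors no choice is balanced.
central-even : ∀ t q → central t (2 * q) ≡ ((2 * q) C q) * t ^ q
central-even t q = begin
  central t (2 * q)
    ≡⟨ central-∑ t (2 * q) ⟩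
  ∑ (suc (2 * q)) (λ m → ((2 * q) C m) * diag t m (2 * q ∸ m))
    ≡⟨ ∑-single (suc (2 * q)) (s≤s (m≤m+n q (q + 0))) offDiag ⟩
  ((2 * q) C q) * diag t q (2 * q ∸ q)
    ≡⟨ cong (λ l → ((2 * q) C q) * diag t q l) (2*m∸m≡m q) ⟩
  ((2 * q) C q) * diag t q q
    ≡⟨ cong (((2 * q) C q) *_) (diag-≡ t q) ⟩
  ((2 * q) C q) * t ^ q ∎
  where
  offDiag : ∀ m → m < suc (2 * q) → m ≢ q → ((2 * q) C m) * diag t m (2 * q ∸ m) ≡ 0
  offDiag m m≤2q m≢q = trans
    (cong (((2 * q) C m) *_) (diag-≢ t m (2 * q ∸ m)
      (λ eq → m≢q (*-cancelˡ-≡ m q 2 (sym (m≡n∸m⇒n≡2*m (≤-pred m≤2q) eq))))))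
    (*-zeroʳ ((2 * q) C m))

central-odd : ∀ t q → central t (1 + 2 * q) ≡ 0
central-odd t q = trans (central-∑ t (1 + 2 * q)) (∑-zero (2 + 2 * q) offDiag)
  where
  offDiag : ∀ m → m < 2 + 2 * q →
            ((1 + 2 * q) C m) * diag t m (1 + 2 * q ∸ m) ≡ 0
  offDiag m m≤j = trans
    (cong (((1 + 2 * q) C m) *_) (diag-≢ t m (1 + 2 * q ∸ m)
      (λ eq → even≢odd m q (sym (m≡n∸m⇒n≡2*m (≤-pred m≤j) eq)))))
    (*-zeroʳ ((1 + 2 * q) C m))

-- One factor `N C k` comes from the inner power, where `diag` leaves only `l = k`, and the other
-- from expanding the outer power. The right side expands the same operator as a power of
-- `(1 + t) + (K + L)`.
∑-C²-expand : ∀ t N → ∑ (suc N) (λ k → (N C k) ^ 2 * t ^ k) ≡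
  ∑ (suc N) (λ j → (N C j) * ((1 + t) ^ (N ∸ j) * central t j))
∑-C²-expand t N = begin
  ∑ (suc N) (λ k → (N C k) ^ 2 * t ^ k)
    ≡⟨ ∑-cong (suc N) (λ k _ → term k) ⟩
  ∑ (suc N) (λ k → (N C k) * (1 ^ (N ∸ k) * ([ 1 +E]^ N) (diag t k)))
    ≡⟨ +E-expand 1 N (λ k → ([ 1 +E]^ N) (diag t k)) ⟨
  ([ 1 +E]^ N) (λ k → ([ 1 +E]^ N) (diag t k))
    ≡⟨ [1+K][1+L]≡[1+t]+[K+L] t N (diag t) (λ _ _ → refl) ⟩
  ([ 1 + t +E]^ N) (central t)
    ≡⟨ +E-expand (1 + t) N (central t) ⟩
  ∑ (suc N) (λ j → (N C j) * ((1 + t) ^ (N ∸ j) * central t j)) ∎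
  where
  square : ∀ x y → x * (x * 1) * y ≡ x * (1 * (x * y))
  square = solve-∀
  term : ∀ k → (N C k) ^ 2 * t ^ k ≡ (N C k) * (1 ^ (N ∸ k) * ([ 1 +E]^ N) (diag t k))
  term k = begin
    (N C k) ^ 2 * t ^ k
      ≡⟨ square (N C k) (t ^ k) ⟩
    (N C k) * (1 * ((N C k) * t ^ k))
      ≡⟨ cong₂ (λ x y → (N C k) * (x * y)) (^-zeroˡ (N ∸ k)) ([1+E]^-diag t N k) ⟨
    (N C k) * (1 ^ (N ∸ k) * ([ 1 +E]^ N) (diag t k)) ∎

D-expand : ∀ N → D N ≡ ∑ (suc N) (λ j → (N C j) * (3 ^ (N ∸ j) * central 2 j))
D-expand N = trans (cong sum (map-upTo (λ k → (N C k) ^ 2 * 2 ^ k) (suc N)))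
                   (∑-C²-expand 2 N)

-- Exact powers of a prime.

^-monoʳ-∣ : ∀ m {i j} → i ≤ j → m ^ i ∣ m ^ j
^-monoʳ-∣ m {i} i≤j with m≤n⇒∃[o]m+o≡n i≤j
... | k , refl = subst (m ^ i ∣_) (sym (^-distribˡ-+-* m i k)) (m∣m*n (m ^ k))

infix 4 _^_∥_
-- Carrying the cofactor allows exact valuations to be multiplied and added without `NonZero`
-- instances; `∥-valuation` and `valuation-∥` translate to and from `valuation`.
record _^_∥_ (p e n : ℕ) : Set where
  constructor cofactor
  field
    {u}     : ℕ
    n≡p^e*u : n ≡ p ^ e * u
    p∤u     : ¬ p ∣ u

∤-* : ∀ {p m n} → Prime p → ¬ p ∣ m → ¬ p ∣ n → ¬ p ∣ m * n
∤-* {m = m} {n} pp p∤m p∤n p∣mn with euclidsLemma m n pp p∣mn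
... | inj₁ p∣m = p∤m p∣m
... | inj₂ p∣n = p∤n p∣n

∤-^ : ∀ {p m} → Prime p → ¬ p ∣ m → ∀ k → ¬ p ∣ m ^ k
∤-^ {p} pp p∤m zero    p∣1 = contradiction (subst Prime (∣1⇒≡1 p∣1) pp) λ ()
∤-^     pp p∤m (suc k) = ∤-* pp p∤m (∤-^ pp p∤m k)

∤⇒∥ : ∀ {p n} → ¬ p ∣ n → p ^ 0 ∥ n
∤⇒∥ {n = n} p∤n = cofactor (sym (*-identityˡ n)) p∤n

∥⇒∣ : ∀ {p e n} → p ^ e ∥ n → p ^ e ∣ n
∥⇒∣ (cofactor {u} refl _) = m∣m*n u

∥-* : ∀ {p d e m n} → Prime p → p ^ d ∥ m → p ^ e ∥ n → p ^ (d + e) ∥ m * n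
∥-* {p} {d} {e} pp (cofactor {u} refl p∤u) (cofactor {v} refl p∤v) = cofactor
  (trans (regroup (p ^ d) u (p ^ e) v)
         (cong (_* (u * v)) (sym (^-distribˡ-+-* p d e))))
  (∤-* pp p∤u p∤v)
  where
  regroup : ∀ a u b v → a * u * (b * v) ≡ a * b * (u * v)
  regroup = solve-∀

-- The equality case of the ultrametric inequality: after `p ^ e` is factored out, the first summand
-- is a multiple of `p` and the second is not.
∥-+ : ∀ {p e m n} → p ^ suc e ∣ m → p ^ e ∥ n → p ^ e ∥ m + n
∥-+ {p} {e} (divides-refl w) (cofactor {u} refl p∤u) = cofactor
  (regroup w p (p ^ e) u) (λ p∣ → p∤u (∣m+n∣m⇒∣n p∣ (m∣m*n w)))
  where
  regroup : ∀ w p a u → w * (p * a) + a * u ≡ a * (p * w + u)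
  regroup = solve-∀

∥-valuation : ∀ p n .{{_ : NonTrivial p}} .{{_ : NonZero n}} →
              p ^ valuation p n ∥ n
∥-valuation p n with ^valuation∣ p n
... | divides u n≡u*p^v = cofactor (trans n≡u*p^v (*-comm u _)) λ p∣u →
  -- A further factor `p` in the cofactor would contradict the maximality of the valuation.
  1+n≰n (^∣⇒≤valuation p n
    (subst (p ^ suc (valuation p n) ∣_) (sym n≡u*p^v) (*-monoˡ-∣ _ p∣u)))

valuation-∥ : ∀ p n .{{_ : NonTrivial p}} .{{_ : NonZero n}} {e} →
              p ^ e ∥ n → valuation p n ≡ e
valuation-∥ p n {e} p^e∥n@(cofactor n≡p^e*u p∤u) =
  ≤-antisym (≮⇒≥ e≮v) (^∣⇒≤valuation p n (∥⇒∣ p^e∥n))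
  where
  instance
    _ = nonTrivial⇒nonZero p
    _ = m^n≢0 p e
  e≮v : ¬ e < valuation p n
  e≮v e<v = p∤u (*-cancelˡ-∣ (p ^ e) (subst₂ _∣_ (*-comm p (p ^ e)) n≡p^e*u
    (∣-trans (^-monoʳ-∣ p e<v) (^valuation∣ p n))))

-- Euclid's lemma moves one factor `p` at a time from the product into `x`.
∤-cancel-^∣ : ∀ {p u} → Prime p → ¬ p ∣ u → ∀ e x → p ^ e ∣ u * x → p ^ e ∣ x
∤-cancel-^∣ pp p∤u zero x _ = 1∣ x
∤-cancel-^∣ {p} {u} pp p∤u (suc e) x p^∣ux
  with euclidsLemma u x pp (∣-trans (m∣m*n (p ^ e)) p^∣ux)
... | inj₁ p∣u = contradiction p∣u p∤u
... | inj₂ (divides-refl y) = subst (p ^ suc e ∣_) (*-comm p y) (*-monoʳ-∣ p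
  (∤-cancel-^∣ pp p∤u e y
    (*-cancelˡ-∣ p (subst (p * p ^ e ∣_) (swap u y p) p^∣ux))))
  where
  instance _ = prime⇒nonZero pp
  swap : ∀ u y p → u * (y * p) ≡ p * (u * y)
  swap = solve-∀

∥-cancel-^∣ : ∀ {p a m} → Prime p → p ^ a ∥ m →
              ∀ e x → p ^ e ∣ m * x → p ^ e ∣ p ^ a * x
∥-cancel-^∣ {p} {a} pp (cofactor {u} refl p∤u) e x p^e∣ =
  ∤-cancel-^∣ pp p∤u e (p ^ a * x) (subst (p ^ e ∣_) (shuffle (p ^ a) u x) p^e∣)
  where
  shuffle : ∀ a u x → a * u * x ≡ u * (a * x)
  shuffle = solve-∀

-- The power of 3 in a factorial.

3-prime : Prime 3
3-prime = from-yes (prime? 3)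

3∤2 : ¬ 3 ∣ 2
3∤2 = >⇒∤ (s<s (s<s z<s))

3∤1+3m : ∀ m → ¬ 3 ∣ 1 + m * 3
3∤1+3m m 3∣ = >⇒∤ {1} {3} (s<s z<s)
  (∣m+n∣m⇒∣n (subst (3 ∣_) (+-comm 1 (m * 3)) 3∣) (n∣m*n m))

3∤2+3m : ∀ m → ¬ 3 ∣ 2 + m * 3
3∤2+3m m 3∣ = 3∤2 (∣m+n∣m⇒∣n (subst (3 ∣_) (+-comm 2 (m * 3)) 3∣) (n∣m*n m))

-- The multiples of 3 up to `m * 3` have product `3 ^ m * m !`; `u` is the product of the remaining
-- factors.
[3m]!-factor : ∀ m → ∃[ u ] (m * 3) ! ≡ 3 ^ m * m ! * u × ¬ 3 ∣ u
[3m]!-factor zero    = 1 , refl , >⇒∤ (s<s z<s)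
[3m]!-factor (suc m) with [3m]!-factor m
... | u , eq , 3∤u =
  (2 + m * 3) * ((1 + m * 3) * u) ,
  trans (cong (λ x → (3 + m * 3) * ((2 + m * 3) * ((1 + m * 3) * x))) eq)
        (regroup m (3 ^ m) (m !) u) ,
  ∤-* 3-prime (3∤2+3m m) (∤-* 3-prime (3∤1+3m m) 3∤u)
  where
  regroup : ∀ m a b u →
    (3 + m * 3) * ((2 + m * 3) * ((1 + m * 3) * (a * b * u))) ≡
    3 * a * ((1 + m) * b) * ((2 + m * 3) * ((1 + m * 3) * u))
  regroup = solve-∀

∥-[3m]! : ∀ {e} m → 3 ^ e ∥ m ! → 3 ^ (m + e) ∥ (m * 3) !
∥-[3m]! {e} m (cofactor {v} m!≡ 3∤v) with [3m]!-factor m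
... | u , eq , 3∤u = cofactor (trans eq (begin
  3 ^ m * m ! * u           ≡⟨ cong (λ x → 3 ^ m * x * u) m!≡ ⟩
  3 ^ m * (3 ^ e * v) * u   ≡⟨ regroup (3 ^ m) (3 ^ e) v u ⟩
  3 ^ m * 3 ^ e * (v * u)   ≡⟨ cong (_* (v * u)) (^-distribˡ-+-* 3 m e) ⟨
  3 ^ (m + e) * (v * u)     ∎)) (∤-* 3-prime 3∤v 3∤u)
  where
  regroup : ∀ a b v u → a * (b * v) * u ≡ a * b * (v * u)
  regroup = solve-∀

∥-[s+3m]! : ∀ {e} s m → s < 3 → 3 ^ e ∥ (m * 3) ! → 3 ^ e ∥ (s + m * 3) !
∥-[s+3m]! 0 m _ 3^e∥ = 3^e∥
∥-[s+3m]! 1 m _ 3^e∥ = ∥-* 3-prime (∤⇒∥ (3∤1+3m m)) 3^e∥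
∥-[s+3m]! 2 m _ 3^e∥ =
  ∥-* 3-prime (∤⇒∥ (3∤2+3m m)) (∥-[s+3m]! 1 m (s<s z<s) 3^e∥)
∥-[s+3m]! (suc (suc (suc s))) m (s<s (s<s (s<s ()))) 3^e∥

-- A weak form of Legendre's formula, in which `2 * a` is `r` minus the base-3 digit sum of `r`.
-- Strong induction with `r = s + 3m` and `s < 3` suffices, because `r !` gains exactly `m` over the
-- exponent of `m !`.
∥-!-bound : ∀ r → 0 < r → ∃[ a ] 3 ^ a ∥ r ! × 2 * a < r
∥-!-bound = <-rec _ step
  where
  module ≤R = ≤-Reasoning
  step : ∀ r → (∀ {m} → m < r → 0 < m → ∃[ a ] 3 ^ a ∥ m ! × 2 * a < m) →
         0 < r → ∃[ a ] 3 ^ a ∥ r ! × 2 * a < r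
  step r rec 0<r = go (r / 3) (m≡m%n+[m/n]*n r 3)
    where
    s = r % 3
    go : ∀ m → r ≡ s + m * 3 → ∃[ a ] 3 ^ a ∥ r ! × 2 * a < r
    -- Here `r < 3`, so `r !` has no factor 3.
    go zero    r≡ = 0 , subst (λ x → 3 ^ 0 ∥ x !) (sym r≡)
      (∥-[s+3m]! s 0 (m%n<n r 3) (∤⇒∥ (>⇒∤ {1} {3} (s<s z<s)))) , 0<r
    go m@(suc m-1) r≡ with rec {m} m<r z<s
      where
      m<r : m < r
      m<r = ≤R.begin-strict
        m         ≤R.<⟨ m<m*n m 3 (s<s z<s) ⟩
        m * 3     ≤R.≤⟨ m≤n+m (m * 3) s ⟩
        s + m * 3 ≤R.≡⟨ sym r≡ ⟩
        r         ≤R.∎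
    ... | a , 3^a∥m! , 2a<m = m + a ,
      subst (λ x → 3 ^ (m + a) ∥ x !) (sym r≡)
        (∥-[s+3m]! s m (m%n<n r 3) (∥-[3m]! m 3^a∥m!)) ,
      (≤R.begin-strict
        2 * (m + a)   ≤R.≡⟨ *-distribˡ-+ 2 m a ⟩
        2 * m + 2 * a ≤R.<⟨ +-monoʳ-< (2 * m) 2a<m ⟩
        2 * m + m     ≤R.≡⟨ triple m ⟩
        m * 3         ≤R.≤⟨ m≤n+m (m * 3) s ⟩
        s + m * 3     ≤R.≡⟨ sym r≡ ⟩
        r             ≤R.∎)
      where
      triple : ∀ m → 2 * m + m ≡ m * 3
      triple = solve-∀

-- For `a ≥ 1` the bound follows from `2 + a ≤ 1 + 2 * a`; only `a = 0` relies on `2 ≤ r`.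
2a<r⇒2+a≤r : ∀ a {r} → 2 ≤ r → 2 * a < r → 2 + a ≤ r
2a<r⇒2+a≤r zero    2≤r _    = 2≤r
2a<r⇒2+a≤r (suc a) _   2a<r = ≤-trans
  (s≤s (s≤s (subst (suc a ≤_) (sym (+-suc a (a + 0))) (s≤s (m≤m+n a (a + 0))))))
  2a<r

-- If `3 ^ a` is the exact power in `r !`, then `3 ^ e` divides `3 ^ a * x`. Since `2 + a ≤ r`,
-- replacing `3 ^ a` by `3 ^ r` gains at least two factors 3.
^∣r!*x⇒^[2+]∣3^r*x : ∀ {r} → 2 ≤ r → ∀ e x → 3 ^ e ∣ r ! * x → 3 ^ (2 + e) ∣ 3 ^ r * x
^∣r!*x⇒^[2+]∣3^r*x {r} 2≤r e x 3^e∣ with ∥-!-bound r (<-trans z<s 2≤r)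
... | a , 3^a∥r! , 2a<r = ∣-trans
  (subst₂ _∣_ (*-assoc 3 3 (3 ^ e)) (regroup (3 ^ a) x)
    (*-monoʳ-∣ 9 (∥-cancel-^∣ 3-prime 3^a∥r! e x 3^e∣)))
  (*-monoˡ-∣ x (^-monoʳ-∣ 3 (2a<r⇒2+a≤r a 2≤r 2a<r)))
  where
  regroup : ∀ a x → 9 * (a * x) ≡ 3 * (3 * a) * x
  regroup = solve-∀

-- Trinomial coefficients.

C*k!*[n∸k]!≡n! : ∀ {n k} → k ≤ n → (n C k) * (k ! * (n ∸ k) !) ≡ n !
C*k!*[n∸k]!≡n! {n} {k} k≤n =
  trans (cong (_* (k ! * (n ∸ k) !)) (nCk≡n!/k![n-k]! k≤n))
        (m/n*n≡m (k![n∸k]!∣n! k≤n))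
  where instance _ = k !* (n ∸ k) !≢0

-- The multinomial coefficient with parts `q`, `q` and `N ∸ 2 * q`.
trinomial : ℕ → ℕ → ℕ
trinomial N q = (N C (2 * q)) * ((2 * q) C q)

trinomial-! : ∀ N q → 2 * q ≤ N →
              trinomial N q * (q ! * q ! * (N ∸ 2 * q) !) ≡ N !
trinomial-! N q 2q≤N = begin
  trinomial N q * (q ! * q ! * (N ∸ 2 * q) !)
    ≡⟨ regroup (N C (2 * q)) ((2 * q) C q) (q ! * q !) ((N ∸ 2 * q) !) ⟩
  (N C (2 * q)) * (((2 * q) C q) * (q ! * q !) * (N ∸ 2 * q) !)
    ≡⟨ cong (λ x → (N C (2 * q)) * (x * (N ∸ 2 * q) !)) [2q]! ⟩
  (N C (2 * q)) * ((2 * q) ! * (N ∸ 2 * q) !)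
    ≡⟨ C*k!*[n∸k]!≡n! 2q≤N ⟩
  N ! ∎
  where
  regroup : ∀ a b c d → a * b * (c * d) ≡ a * (b * c * d)
  regroup = solve-∀
  [2q]! : ((2 * q) C q) * (q ! * q !) ≡ (2 * q) !
  [2q]! = trans
    (cong (λ x → ((2 * q) C q) * (q ! * x !)) (sym (2*m∸m≡m q)))
    (C*k!*[n∸k]!≡n! (m≤m+n q (q + 0)))

-- The right side is `N ! / (q !)²` and the left side is `N ! / ((n !)² s)` with
-- `s = (N ∸ 2 * n) !`. With `w = n ! / q !` their quotient is `w * w * s`; the equation is checked
-- after multiplication by `q ! * q !`.
trinomial∣[N∸2q]!*trinomial : ∀ {N n q} → 2 * n ≤ N → q ≤ n →
  trinomial N n ∣ (N ∸ 2 * q) ! * trinomial N q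
trinomial∣[N∸2q]!*trinomial {N} {n} {q} 2n≤N q≤n with m≤n⇒m!∣n! q≤n
... | divides w n!≡w*q! = divides (w * w * s) (*-cancelˡ-≡ _ _ (q ! * q !) (begin
  q ! * q ! * (r * X)
    ≡⟨ left (q !) r X ⟩
  X * (q ! * q ! * r)
    ≡⟨ trinomial-! N q (≤-trans (*-monoʳ-≤ 2 q≤n) 2n≤N) ⟩
  N !
    ≡⟨ trinomial-! N n 2n≤N ⟨
  M * (n ! * n ! * s)
    ≡⟨ cong (λ x → M * (x * x * s)) n!≡w*q! ⟩
  M * (w * q ! * (w * q !) * s)
    ≡⟨ right M w (q !) s ⟩
  q ! * q ! * (w * w * s * M) ∎))
  where
  instance _ = q !* q !≢0
  r = (N ∸ 2 * q) !
  s = (N ∸ 2 * n) !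
  X = trinomial N q
  M = trinomial N n
  left : ∀ f r x → f * f * (r * x) ≡ x * (f * f * r)
  left = solve-∀
  right : ∀ m w f s → m * (w * f * (w * f) * s) ≡ f * f * (w * w * s * m)
  right = solve-∀

-- The terms of the expansion and the valuation of `D`.

parity : ∀ j → ∃[ q ] (j ≡ 2 * q ⊎ j ≡ 1 + 2 * q)
parity zero = 0 , inj₁ refl
parity (suc j) with parity j
... | q , inj₁ refl = q , inj₂ refl
... | q , inj₂ refl = suc q , inj₁ (cong suc (sym (+-suc q (q + 0))))

term : ℕ → ℕ → ℕ
term N j = (N C j) * (3 ^ (N ∸ j) * central 2 j)

term-even : ∀ N q → term N (2 * q) ≡ 3 ^ (N ∸ 2 * q) * trinomial N q * 2 ^ q
term-even N q = trans
  (cong (λ x → (N C (2 * q)) * (3 ^ (N ∸ 2 * q) * x)) (central-even 2 q))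
  (regroup (N C (2 * q)) (3 ^ (N ∸ 2 * q)) ((2 * q) C q) (2 ^ q))
  where
  regroup : ∀ a b c d → a * (b * (c * d)) ≡ b * (a * c) * d
  regroup = solve-∀

term-odd : ∀ N q → term N (1 + 2 * q) ≡ 0
term-odd N q = trans
  (cong (λ x → (N C (1 + 2 * q)) * (3 ^ (N ∸ (1 + 2 * q)) * x)) (central-odd 2 q))
  (trans (cong ((N C (1 + 2 * q)) *_) (*-zeroʳ (3 ^ (N ∸ (1 + 2 * q)))))
         (*-zeroʳ (N C (1 + 2 * q))))

^[2+]∣term : ∀ {N n e} → 2 * n ≤ N → 3 ^ e ∣ trinomial N n →
             ∀ j → j < 2 * n → 3 ^ (2 + e) ∣ term N j
^[2+]∣term {N} {n} {e} 2n≤N 3^e∣M j j<2n with parity j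
... | q , inj₂ refl = subst (3 ^ (2 + e) ∣_) (sym (term-odd N q)) (_ ∣0)
... | q , inj₁ refl = subst (3 ^ (2 + e) ∣_) (sym (term-even N q))
  (∣m⇒∣m*n (2 ^ q) (^∣r!*x⇒^[2+]∣3^r*x 2≤r e (trinomial N q)
    (∣-trans 3^e∣M (trinomial∣[N∸2q]!*trinomial 2n≤N (<⇒≤ q<n)))))
  where
  q<n : q < n
  q<n = *-cancelˡ-< 2 q n j<2n
  2≤r : 2 ≤ N ∸ 2 * q
  -- From `q < n` follows `2 + 2 * q ≤ 2 * n ≤ N`.
  2≤r = m+n≤o⇒m≤o∸n 2 (≤-trans
    (subst (_≤ 2 * n) (*-suc 2 q) (*-monoʳ-≤ 2 q<n)) 2n≤N)

-- The term at `j = 2 * n` has exact exponent `s + e`, as `2 ^ n` is prime to 3, and it dominates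
-- all earlier terms. The sum stops there so that both parities of `N` are covered.
∑-term-∥ : ∀ {N n e} → 2 * n ≤ N → N ≤ 1 + 2 * n → 3 ^ e ∥ trinomial N n →
           3 ^ (N ∸ 2 * n + e) ∥ ∑ (suc (2 * n)) (term N)
∑-term-∥ {N} {n} {e} 2n≤N N≤1+2n 3^e∥M =
  subst (3 ^ (s + e) ∥_) (sym (∑-suc (2 * n) (term N))) (∥-+
    -- The earlier terms must exceed `s + e` by at least one; the margin of 2 provides this because
    -- `s ≤ 1`.
    (∣-trans (^-monoʳ-∣ 3 (s≤s (+-monoˡ-≤ e s≤1)))
      (∑-∣ (2 * n) (^[2+]∣term {n = n} {e} 2n≤N (∥⇒∣ 3^e∥M))))
    (subst (3 ^ (s + e) ∥_) (sym (term-even N n)) last))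
  where
  s = N ∸ 2 * n
  s≤1 : s ≤ 1
  s≤1 = m≤n+o⇒m∸n≤o N (2 * n) (subst (N ≤_) (+-comm 1 (2 * n)) N≤1+2n)
  last : 3 ^ (s + e) ∥ 3 ^ s * trinomial N n * 2 ^ n
  last = subst (3 ^_∥ 3 ^ s * trinomial N n * 2 ^ n) (+-identityʳ (s + e))
    (∥-* 3-prime
      (∥-* 3-prime (cofactor (sym (*-identityʳ (3 ^ s))) (>⇒∤ (s<s z<s))) 3^e∥M)
      (∤⇒∥ (∤-^ 3-prime 3∤2 n)))

D-even-∥ : ∀ n {e} → 3 ^ e ∥ (2 * n) C n → 3 ^ e ∥ D (2 * n)
D-even-∥ n {e} 3^e∥C = subst₂ (3 ^_∥_)
  (cong (_+ e) (n∸n≡0 (2 * n))) (sym (D-expand (2 * n)))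
  (∑-term-∥ {n = n} ≤-refl (n≤1+n (2 * n)) (subst (3 ^ e ∥_) (sym M≡) 3^e∥C))
  where
  M≡ : trinomial (2 * n) n ≡ (2 * n) C n
  M≡ = trans (cong (_* ((2 * n) C n)) (nCn≡1 (2 * n))) (*-identityˡ ((2 * n) C n))

-- Now `s = 1` supplies the extra factor 3, and `N C (2 * n) = N` supplies the factor `1 + 2 * n`.
D-odd-∥ : ∀ n {e} → 3 ^ e ∥ (1 + 2 * n) * ((2 * n) C n) → 3 ^ suc e ∥ D (1 + 2 * n)
D-odd-∥ n {e} 3^e∥ = subst₂ (3 ^_∥_)
  (cong (_+ e) (m+n∸n≡m 1 (2 * n))) (sym D≡)
  (∑-term-∥ {n = n} (n≤1+n (2 * n)) ≤-refl (subst (3 ^ e ∥_) (sym M≡) 3^e∥))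
  where
  N = 1 + 2 * n
  D≡ : D N ≡ ∑ N (term N)
  D≡ = begin
    D N                       ≡⟨ D-expand N ⟩
    ∑ (suc N) (term N)        ≡⟨ ∑-suc N (term N) ⟩
    -- The last index `N` is odd, so its term vanishes and the sum ends at `2 * n`.
    ∑ N (term N) + term N N   ≡⟨ cong (∑ N (term N) +_) (term-odd N n) ⟩
    ∑ N (term N) + 0          ≡⟨ +-identityʳ _ ⟩
    ∑ N (term N)              ∎
  M≡ : trinomial N n ≡ N * ((2 * n) C n)
  M≡ = cong (_* ((2 * n) C n)) (begin
    N C (2 * n)       ≡⟨ nCk≡nC[n∸k] (n≤1+n (2 * n)) ⟩
    N C (N ∸ 2 * n)   ≡⟨ cong (N C_) (m+n∸n≡m 1 (2 * n)) ⟩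
    N C 1             ≡⟨ nC1≡n N ⟩
    N                 ∎)

theorem5 : (n : ℕ) →
    (v₃ (D (1 + 2 * n)) ≡ 1 + v₃ (1 + 2 * n) + v₃ ((2 * n) C n) {{2nCn-nonZero n}}) ×
    (v₃ (D (2 * n)) ≡ v₃ ((2 * n) C n) {{2nCn-nonZero n}})
theorem5 n =
  valuation-∥ 3 (D (1 + 2 * n))
    (D-odd-∥ n (∥-* 3-prime (∥-valuation 3 (1 + 2 * n)) 3^v∥C)) ,
  valuation-∥ 3 (D (2 * n)) (D-even-∥ n 3^v∥C)
  where
  instance _ = 2nCn-nonZero n
  3^v∥C : 3 ^ v₃ ((2 * n) C n) ∥ (2 * n) C n
  3^v∥C = ∥-valuation 3 ((2 * n) C n)
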